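{- Let $m,n$ be positive integers and let $\mathbf{h}=(h_1,\ldots,h_m)$ and $\mathbf{k}=(k_1,\ldots,k_n)$ be sequences of nonnegative integers. There exists a $\mathrm{NASM}(m,n;\mathbf{h},\mathbf{k})$ if and only if there exists a binary array $A\in\Phi(m,n;\mathbf{h},\mathbf{k})$ such that the graph $\Gamma(A)$ is bipartite.
   Context: The weight of a row (or column) of an integer matrix is the number of its nonzero entries. For an $m\times n$ matrix $A$, the row-weight sequence $w_r(A)$ is the sequence $(h_1,\ldots,h_m)$ where $h_i$ is the weight of row $i$, and the column-weight sequence $w_c(A)$ is the sequence $(k_1,\ldots,k_n)$ where $k_j$ is the weight of column $j$. $\Phi(m,n)$ is the set of all $m\times n$ arrays with entries in $\{0,1\}$ (binary arrays), and $\Psi(m,n)$ is the set of all $m\times n$ arrays with entries in $\{0,1,-1\}$. $\Phi(m,n;\mathbf{h},\mathbf{k})$ (respectively $\Psi(m,n;\mathbf{h},\mathbf{k})$) is the subset of those arrays $A$ with $w_r(A)=\mathbf{h}$ and $w_c(A)=\mathbf{k}$. An array $A\in\Psi(m,n)$ is a near alternating sign matrix (NASM) if in each row and in each column the nonzero entries alternate in sign (i.e. any two consecutive nonzero entries of a row or column, ignoring zeros, have opposite signs). A $\mathrm{NASM}(m,n;\mathbf{h},\mathbf{k})$ is a NASM belonging to $\Psi(m,n;\mathbf{h},\mathbf{k})$. For a binary array $A=(a_{ij})\in\Phi(m,n)$, $\Gamma(A)$ is the simple graph with vertex set $\{(i,j)\in\{1,\ldots,m\}\times\{1,\ldots,n\}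 : a_{ij}=1\}$, in which two vertices are adjacent if and only if the corresponding entries are consecutive nonzero entries of the same row or of the same column (they lie in the same row or the same column, and all entries of that row or column strictly between them are $0$). A graph is bipartite if it has a proper vertex-coloring with at most two colors. -}

module Defs where

open import Data.Fin.Base using (Fin; _<_)
open import Data.Fin.Properties using (<-irrefl)
open import Data.Integer.Base using (ℤ; 0ℤ; 1ℤ; -1ℤ; sign)
open import Data.Integer.Properties using (_≟_)
open import Data.Nat.Base using (ℕ)
open import Data.Product.Base using (Σ-syntax; _×_; _,_)
open import Data.Sign.Base using (opposite)
open import Data.Sum.Base using (_⊎_; inj₁; inj₂; swap)
open import Data.Vec.Base using (count; tabulate)
open import Data.Vec.Functional using (Vector; transpose)
open import Relation.Binary.PropositionalEquality using (_≡_; _≢_; _≗_; refl)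
open import Relation.Nullary using (¬_)
open import Relation.Nullary.Decidable using (¬?)

private
  variable
    m n : ℕ

Matrix : ℕ → ℕ → Set
Matrix m n = Vector (Vector ℤ n) m

column : Matrix m n → Fin n → Vector ℤ m
column = transpose

weight : Vector ℤ n → ℕ
weight v = count (λ z → ¬? (z ≟ 0ℤ)) (tabulate v)

rowWeights : Matrix m n → Vector ℕ m
rowWeights A i = weight (A i)

columnWeights : Matrix m n → Vector ℕ n
columnWeights A j = weight (column A j)

-- The sets of arrays are predicates on integer matrices, so that binary
-- arrays and {0, 1, -1}-arrays share one notion of weight.

Φ : ∀ m n → Matrix m n → Set
Φ m n A = ∀ i j → A i j ≡ 0ℤ ⊎ A i j ≡ 1ℤ

Ψ : ∀ m n → Matrix m n → Set
Ψ m n A = ∀ i j → A i j ≡ 0ℤ ⊎ A i j ≡ 1ℤ ⊎ A i j ≡ -1ℤ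

Φ[_,_] : Vector ℕ m → Vector ℕ n → Matrix m n → Set
Φ[_,_] {m} {n} h k A = Φ m n A × rowWeights A ≗ h × columnWeights A ≗ k

Ψ[_,_] : Vector ℕ m → Vector ℕ n → Matrix m n → Set
Ψ[_,_] {m} {n} h k A = Ψ m n A × rowWeights A ≗ h × columnWeights A ≗ k

-- Positions a < b of successive nonzero entries, in this order.
record Consecutive (v : Vector ℤ n) (a b : Fin n) : Set where
  field
    ordered  : a < b
    nonzeroˡ : v a ≢ 0ℤ
    nonzeroʳ : v b ≢ 0ℤ
    between  : ∀ c → a < c → c < b → v c ≡ 0ℤ

-- The library sets  sign 0ℤ  to  + , but  sign  is applied here to nonzero
-- entries only.
Alternating : Vector ℤ n → Set
Alternating v = ∀ a b → Consecutive v a b → sign (v b) ≡ opposite (sign (v a))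

IsNASM : Matrix m n → Set
IsNASM A = (∀ i → Alternating (A i)) × (∀ j → Alternating (column A j))

NASM[_,_] : Vector ℕ m → Vector ℕ n → Matrix m n → Set
NASM[ h , k ] A = Ψ[ h , k ] A × IsNASM A

record SimpleGraph : Set₁ where
  field
    Vertex   : Set
    Adjacent : Vertex → Vertex → Set
    symmetric   : ∀ {x y} → Adjacent x y → Adjacent y x
    irreflexive : ∀ {x} → ¬ Adjacent x x

Bipartite : SimpleGraph → Set
Bipartite G = Σ[ colour ∈ (Vertex → Fin 2) ] (∀ x y → Adjacent x y → colour x ≢ colour y)
  where open SimpleGraph G

Neighbours : Vector ℤ n → Fin n → Fin n → Set
Neighbours v a b = Consecutive v a b ⊎ Consecutive v b a

¬neighbours-refl : {v : Vector ℤ n} {a : Fin n} → ¬ Neighbours v a a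
¬neighbours-refl (inj₁ c) = <-irrefl refl (Consecutive.ordered c)
¬neighbours-refl (inj₂ c) = <-irrefl refl (Consecutive.ordered c)

-- Equality on ℤ is proof-irrelevant, so a position carries at most one vertex.
ΓVertex : Matrix m n → Set
ΓVertex {m} {n} A = Σ[ (i , j) ∈ Fin m × Fin n ] A i j ≡ 1ℤ

ΓAdjacent : (A : Matrix m n) → ΓVertex A → ΓVertex A → Set
ΓAdjacent A ((i , j) , _) ((i′ , j′) , _) =
  (i ≡ i′ × Neighbours (A i) j j′) ⊎ (j ≡ j′ × Neighbours (column A j) i i′)

Γ : Matrix m n → SimpleGraph
Γ A = record
  { Vertex      = ΓVertex A
  ; Adjacent    = ΓAdjacent A
  ; symmetric   = λ { (inj₁ (refl , p)) → inj₁ (refl , swap p)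
                    ; (inj₂ (refl , p)) → inj₂ (refl , swap p) }
  ; irreflexive = λ { (inj₁ (_ , p)) → ¬neighbours-refl p
                    ; (inj₂ (_ , p)) → ¬neighbours-refl p }
  }

{-# OPTIONS --safe #-}
-- Taking absolute values turns a NASM into a binary array with the same nonzero
-- positions, hence the same weights and the same consecutive pairs. The signs of
-- the entries are a vertex colouring, and alternation along rows and columns says
-- exactly that it is proper; conversely a proper 2-colouring provides the signs.
module Submission where

open import Defs
open import Data.Bool.Base using (if_then_else_)
open import Data.Fin.Base using (Fin; zero; suc)
open import Data.Integer.Base using (ℤ; +_; 0ℤ; 1ℤ; ∣_∣; sign; _◃_)
open import Data.Integer.Properties
  using (_≟_; ∣i∣≡0⇒i≡0; abs-◃; sign-◃)
open import Data.Nat.Base using (ℕ; NonZero; zero; suc)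
open import Data.Product.Base using (∃-syntax; _×_; _,_)
open import Data.Sign.Base as Sign using (Sign; opposite)
open import Data.Sum.Base using (inj₁; inj₂; [_,_]′)
open import Data.Vec.Functional using (Vector)
open import Function.Base using (_∘_; id)
open import Function.Bundles using (_⇔_; mk⇔)
open import Relation.Binary.PropositionalEquality
  using (_≡_; _≢_; refl; sym; trans; cong; cong₂; module ≡-Reasoning)
open import Relation.Nullary.Decidable using (yes; no; ¬?; does-⇔)
open import Relation.Nullary.Negation using (contradiction)
open import Axiom.UniquenessOfIdentityProofs using (module Decidable⇒UIP)

private
  variable
    m n : ℕ
    v w : Vector ℤ n
    A : Matrix m n
    x y : ℤ

abs-zero : ∣ x ∣ ≡ ∣ y ∣ → x ≡ 0ℤ → y ≡ 0ℤ
abs-zero eq x≡0 = ∣i∣≡0⇒i≡0 (trans (sym eq) (cong ∣_∣ x≡0))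

weight-abs : (v w : Vector ℤ n) → (∀ a → ∣ v a ∣ ≡ ∣ w a ∣) → weight v ≡ weight w
weight-abs {zero}  v w eq = refl
-- `count` consults only the Boolean of each decision, so it is enough that both tests for a nonzero
-- head have the same truth value.
weight-abs {suc n} v w eq = cong₂ (λ b → if b then suc else id)
  (does-⇔ nonzero⇔ (¬? (v zero ≟ 0ℤ)) (¬? (w zero ≟ 0ℤ)))
  (weight-abs (v ∘ suc) (w ∘ suc) (eq ∘ suc))
  where
  nonzero⇔ : v zero ≢ 0ℤ ⇔ w zero ≢ 0ℤ
  nonzero⇔ = mk⇔ (_∘ abs-zero (sym (eq zero))) (_∘ abs-zero (eq zero))

-- Consecutiveness depends only on where the zeros lie, and absolute values determine that.
consecutive-abs : (∀ a → ∣ v a ∣ ≡ ∣ w a ∣) → ∀ {a b} → Consecutive v a b → Consecutive w a b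
consecutive-abs eq {a} {b} ab = record
  { ordered  = ordered
  ; nonzeroˡ = nonzeroˡ ∘ abs-zero (sym (eq a))
  ; nonzeroʳ = nonzeroʳ ∘ abs-zero (sym (eq b))
  ; between  = λ c a<c c<b → abs-zero (eq c) (between c a<c c<b)
  }
  where open Consecutive ab

Φ-nonzero : Φ m n A → ∀ {i j} → A i j ≢ 0ℤ → A i j ≡ 1ℤ
Φ-nonzero φ {i} {j} ≢0 = [ (λ ≡0 → contradiction ≡0 ≢0) , id ]′ (φ i j)

toColour : Sign → Fin 2
toColour Sign.+ = zero
toColour Sign.- = suc zero

fromColour : Fin 2 → Sign
fromColour zero       = Sign.+
fromColour (suc zero) = Sign.-

toColour-opposite : ∀ {s t} → t ≡ opposite s → toColour s ≢ toColour t
toColour-opposite {Sign.+} refl ()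
toColour-opposite {Sign.-} refl ()

-- Having just two colours matters here: a colour other than `c` is forced to be the remaining one.
fromColour-≢ : ∀ {c d} → c ≢ d → fromColour d ≡ opposite (fromColour c)
fromColour-≢ {zero}     {zero}     c≢d = contradiction refl c≢d
fromColour-≢ {zero}     {suc zero} c≢d = refl
fromColour-≢ {suc zero} {zero}     c≢d = refl
fromColour-≢ {suc zero} {suc zero} c≢d = contradiction refl c≢d

absolute : Matrix m n → Matrix m n
absolute A i j = + ∣ A i j ∣

absolute-Φ : Ψ m n A → Φ m n (absolute A)
absolute-Φ ψ i j with ψ i j
... | inj₁ eq        = inj₁ (cong (+_ ∘ ∣_∣) eq)
... | inj₂ (inj₁ eq) = inj₂ (cong (+_ ∘ ∣_∣) eq)
... | inj₂ (inj₂ eq) = inj₂ (cong (+_ ∘ ∣_∣) eq)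

alternating-colours : Alternating v → (∀ a → ∣ w a ∣ ≡ ∣ v a ∣) → ∀ {a b} → Neighbours w a b →
  toColour (sign (v a)) ≢ toColour (sign (v b))
alternating-colours alt eq (inj₁ ab) = toColour-opposite (alt _ _ (consecutive-abs eq ab))
-- Alternation speaks of ordered pairs, so a reversed pair is handled by symmetry of the inequality.
alternating-colours alt eq (inj₂ ba) = toColour-opposite (alt _ _ (consecutive-abs eq ba)) ∘ sym

absolute-bipartite : IsNASM A → Bipartite (Γ (absolute A))
absolute-bipartite {A = A} (rows , columns) =
  (λ ((i , j) , _) → toColour (sign (A i j))) ,
  -- `refl` suffices for the moduli, since `∣ + ∣ x ∣ ∣` computes to `∣ x ∣`.
  λ { ((i , _) , _) _ (inj₁ (refl , ab)) → alternating-colours (rows i) (λ _ → refl) ab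
    ; ((_ , j) , _) _ (inj₂ (refl , ab)) → alternating-colours (columns j) (λ _ → refl) ab }

withSigns : (Fin m → Fin n → Sign) → Matrix m n → Matrix m n
withSigns s A i j = s i j ◃ ∣ A i j ∣

withSigns-Ψ : ∀ s → Φ m n A → Ψ m n (withSigns s A)
withSigns-Ψ s φ i j with s i j | φ i j
-- Any sign will do, because `s ◃ 0` computes to `0ℤ`.
... | _      | inj₁ eq rewrite eq = inj₁ refl
... | Sign.+ | inj₂ eq rewrite eq = inj₂ (inj₁ refl)
... | Sign.- | inj₂ eq rewrite eq = inj₂ (inj₂ refl)

-- Off the vertices the sign is irrelevant, since it is multiplied by zero.
extend : (A : Matrix m n) → (ΓVertex A → Fin 2) → Fin m → Fin n → Sign
extend A colour i j with A i j ≟ 1ℤ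
... | yes p = fromColour (colour ((i , j) , p))
... | no _  = Sign.+

-- The equality proof produced by the decision need not be `p` itself. Uniqueness of identity
-- proofs, from decidable equality on ℤ, identifies the two vertices.
extend-vertex : (A : Matrix m n) (colour : ΓVertex A → Fin 2) → ∀ {i j} (p : A i j ≡ 1ℤ) →
  extend A colour i j ≡ fromColour (colour ((i , j) , p))
extend-vertex A colour {i} {j} p with A i j ≟ 1ℤ
... | yes q = cong (λ r → fromColour (colour ((i , j) , r))) (Decidable⇒UIP.≡-irrelevant _≟_ q p)
... | no ¬p = contradiction p ¬p

module _ {A : Matrix m n} (φ : Φ m n A)
  (colour : ΓVertex A → Fin 2) (proper : ∀ x y → ΓAdjacent A x y → colour x ≢ colour y)
  where

  signed : Matrix m n
  signed = withSigns (extend A colour) A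

  signed-abs : ∀ i j → ∣ signed i j ∣ ≡ ∣ A i j ∣
  signed-abs i j = abs-◃ (extend A colour i j) ∣ A i j ∣

  sign-signed : ∀ {i j} (p : A i j ≡ 1ℤ) → sign (signed i j) ≡ fromColour (colour ((i , j) , p))
  sign-signed {i} {j} p = begin
    sign (s ◃ ∣ A i j ∣)              ≡⟨ cong (λ z → sign (s ◃ ∣ z ∣)) p ⟩
    -- The sign survives `_◃_` only for a nonzero modulus, hence the preceding rewriting to the
    -- literal `1`.
    sign (s ◃ 1)                      ≡⟨ sign-◃ s 1 ⟩
    s                                 ≡⟨ extend-vertex A colour p ⟩
    fromColour (colour ((i , j) , p)) ∎
    where
    open ≡-Reasoning
    s = extend A colour i j

  signed-opposite : ∀ {i j i′ j′} (p : A i j ≡ 1ℤ) (q : A i′ j′ ≡ 1ℤ) →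
    ΓAdjacent A ((i , j) , p) ((i′ , j′) , q) →
    sign (signed i′ j′) ≡ opposite (sign (signed i j))
  signed-opposite p q adjacent = begin
    _ ≡⟨ sign-signed q ⟩
    _ ≡⟨ fromColour-≢ (proper (_ , p) (_ , q) adjacent) ⟩
    _ ≡⟨ cong opposite (sign-signed p) ⟨
    _ ∎
    where open ≡-Reasoning

  -- A consecutive pair of `signed` is also one of `A`. Its ends are nonzero binary entries, hence
  -- equal to `1ℤ`, so they are adjacent vertices of `Γ A` and properness applies.
  signed-IsNASM : IsNASM signed
  signed-IsNASM =
    (λ i a b ab → let ab′ = consecutive-abs (signed-abs i) ab in
      signed-opposite (Φ-nonzero φ (Consecutive.nonzeroˡ ab′)) (Φ-nonzero φ (Consecutive.nonzeroʳ ab′))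
        (inj₁ (refl , inj₁ ab′))) ,
    (λ j a b ab → let ab′ = consecutive-abs (λ i → signed-abs i j) ab in
      signed-opposite (Φ-nonzero φ (Consecutive.nonzeroˡ ab′)) (Φ-nonzero φ (Consecutive.nonzeroʳ ab′))
        (inj₂ (refl , inj₁ ab′)))

theorem2p3 : ∀ (m n : ℕ) .{{_ : NonZero m}} .{{_ : NonZero n}} (h : Vector ℕ m) (k : Vector ℕ n) →
    (∃[ A ] NASM[ h , k ] A) ⇔ (∃[ A ] (Φ[ h , k ] A × Bipartite (Γ A)))
theorem2p3 m n h k = mk⇔
  (λ (A , (ψ , rows , columns) , nasm) →
    absolute A ,
    (absolute-Φ ψ ,
     (λ i → trans (weight-abs (absolute A i) (A i) (λ _ → refl)) (rows i)) ,
     (λ j → trans (weight-abs (column (absolute A) j) (column A j) (λ _ → refl)) (columns j))) ,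
    absolute-bipartite nasm)
  (λ (A , (φ , rows , columns) , colour , proper) →
    signed φ colour proper ,
    (withSigns-Ψ _ φ ,
     (λ i → trans (weight-abs (signed φ colour proper i) (A i) (signed-abs φ colour proper i)) (rows i)) ,
     (λ j → trans (weight-abs (column (signed φ colour proper) j) (column A j)
              (λ i → signed-abs φ colour proper i j)) (columns j))) ,
    signed-IsNASM φ colour proper)
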